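{- Let $k\ge 2$, and let $D$ be a digraph of order $n$ that has property $S_k$. Then $D$ has at least $kn$ edges, and if $D$ has exactly $kn$ edges then $D$ is isomorphic to some element of $\mathcal A(n,k)$.
   Context: Digraphs are finite and have no loops; between two distinct vertices $x,y$ there may be an edge from $x$ to $y$, an edge from $y$ to $x$, both, or neither (no repeated edges in the same direction). The order of a digraph is its number of vertices. A digraph with at least $k+1$ vertices has property $S_k$ if for every $k$-set $B$ of vertices there is a vertex $u$ such that $B$ is contained in the outneighbourhood of $u$ (that is, there is a directed edge from $u$ to every element of $B$). For $n\ge k+1$, $\mathcal A(n,k)$ is the family of all digraphs on vertex set $[n]=\{1,\dots,n\}$ whose edges are exactly: (i) all $k(k+1)$ directed edges between distinct elements of $[k+1]$ (in both directions); and (ii) for each $i\in[n]$ with $i>k+1$, directed edges to $i$ from exactly $k$ elements of $[k+1]$ (the choice of the $k$ elements may depend arbitrarily on $i$). -}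

module Defs where

open import Data.Fin.Base using (Fin; toℕ)
open import Data.Fin.Permutation using (Permutation′; _⟨$⟩ʳ_)
open import Data.Fin.Subset using (Subset; _∈_; ∣_∣)
open import Data.List.Base using (List; allFin; cartesianProduct; filter; length)
open import Data.Nat.Base using (ℕ; suc; _≤_; _<_)
open import Data.Product.Base using (∃; _×_; _,_)
open import Data.Sum.Base using (_⊎_)
open import Function.Bundles using (_⇔_)
open import Level using (0ℓ)
open import Relation.Binary.Core using (Rel)
open import Relation.Binary.Definitions using (Decidable)
open import Relation.Binary.PropositionalEquality.Core using (_≡_; _≢_)
open import Relation.Nullary.Negation.Core using (¬_)

-- A digraph of order n has vertex set Fin n.  Opposite edges x ⟶ y and y ⟶ x
-- may coexist.
record Digraph (n : ℕ) : Set₁ where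
  infix 4 _⟶_ _⟶?_
  field
    _⟶_      : Rel (Fin n) 0ℓ
    _⟶?_     : Decidable _⟶_
    loopless : ∀ x → ¬ (x ⟶ x)

  -- Each ordered pair is tested once, so the list has no repetitions.
  edges : List (Fin n × Fin n)
  edges = filter (λ (x , y) → x ⟶? y) (cartesianProduct (allFin n) (allFin n))

  ∣E∣ : ℕ
  ∣E∣ = length edges

record HasS {n : ℕ} (k : ℕ) (D : Digraph n) : Set where
  open Digraph D
  field
    order     : suc k ≤ n
    dominated : ∀ (B : Subset n) → ∣ B ∣ ≡ k → ∃ λ u → ∀ {v} → v ∈ B → u ⟶ v

infix 4 _≅_

_≅_ : ∀ {n} → Digraph n → Digraph n → Set
_≅_ {n} D D′ = ∃ λ (π : Permutation′ n) →
  ∀ x y → (x D.⟶ y) ⇔ ((π ⟨$⟩ʳ x) D′.⟶ (π ⟨$⟩ʳ y))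
  where
  module D  = Digraph D
  module D′ = Digraph D′

-- The set [k+1] = {1, …, k+1}: the vertex i ∈ {1, …, n} is the element of
-- Fin n with value i - 1.
Core : ∀ {n} → ℕ → Fin n → Set
Core k x = toℕ x < suc k

-- The values of `choice` on [k+1] are unconstrained and play no role.
record 𝒜 (n k : ℕ) (A : Digraph n) : Set where
  open Digraph A
  field
    order       : suc k ≤ n
    choice      : Fin n → Subset n
    choice-core : ∀ i → ¬ Core k i → ∀ {x} → x ∈ choice i → Core k x
    choice-size : ∀ i → ¬ Core k i → ∣ choice i ∣ ≡ k
    edge⇔       : ∀ x y → (x ⟶ y) ⇔
                    ((Core k x × Core k y × x ≢ y) ⊎ (¬ Core k y × x ∈ choice y))

{-# OPTIONS --safe #-}

-- Write N v for the set of in-neighbours of v.  If ∣N v∣ < k, then a dominator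
-- of N v ∪ {v} would be a member of N v, hence a loop; so ∣N v∣ ≥ k for all v,
-- and summing over v bounds the number of edges.  If there are exactly k n
-- edges, every ∣N v∣ equals k.  For w ∈ N v, the dominator of (N v - w) ∪ {v}
-- can only be w, so every N v is a clique.  Adding to N v a dominator u of N v
-- gives a clique K with k + 1 elements, and by counting N x ⊆ K for x ∈ K.
-- Finally take any w and some x ∈ K.  A dominator z of {x, w}
-- lies in N x ⊆ K; any other y ∈ N w is an in-neighbour of z, as N w is a
-- clique, so y ∈ K.  Hence all in-neighbourhoods are contained in K.
module Submission where

open import Defs
open import Algebra.Properties.CommutativeMonoid.Sum using (sum; sum-cong-≗; sum-permute; ∑-comm)
open import Data.Bool.Base using (Bool; true; false; if_then_else_)
open import Data.Fin.Base using (Fin; zero; suc; toℕ; fromℕ<; punchIn)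
open import Data.Fin.Permutation using (Permutation′; _⟨$⟩ʳ_; _⟨$⟩ˡ_; id; lift₀; insert; insert-punchIn; inverseˡ; inverseʳ; flip)
open import Data.Fin.Properties using (_≟_; toℕ-fromℕ<)
open import Data.Fin.Subset using (Subset; inside; outside; _∈_; _⊆_; ∣_∣; ⁅_⁆; _∪_; _-_; ⊤)
open import Data.Fin.Subset.Properties
open import Data.List.Base as List using (length; filter; cartesianProduct; _++_)
open import Data.List.Properties using (filter-++; length-++)
open import Data.Nat.Base using (ℕ; zero; suc; _+_; _*_; _≤_; _<_; z≤n; s≤s; s≤s⁻¹)
open import Data.Nat.Properties using (+-0-commutativeMonoid; +-mono-≤; +-monoʳ-≤; +-cancelʳ-≤; +-cancelˡ-≡; +-suc; +-comm; *-comm; ≤-reflexive; ≤-trans; ≤-antisym; <-irrefl; n≤1+n; ≰⇒>; _≤?_; _<?_; module ≤-Reasoning)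
open import Data.Product.Base using (∃; _×_; _,_; proj₁; proj₂)
open import Data.Sum.Base using (_⊎_; inj₁; inj₂)
open import Data.Vec.Base using ([]; _∷_; here; there; tabulate)
open import Data.Vec.Properties using ([]=⇒lookup; lookup⇒[]=; lookup∘tabulate)
open import Function.Base using (_∘_)
open import Function.Bundles using (_⇔_; mk⇔; module Equivalence)
open import Level using (0ℓ)
open import Relation.Binary.PropositionalEquality using (_≡_; _≢_; refl; sym; trans; cong; cong₂; subst; subst₂; module ≡-Reasoning)
open import Relation.Nullary.Decidable using (yes; no; does; dec-true; decidable-stable)
open import Relation.Nullary.Negation using (¬_; contradiction)
open import Relation.Unary using (Pred; Decidable)

private
  variable
    n : ℕ

-- Finite sums and counting as summation.

∑ : (Fin n → ℕ) → ℕ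
∑ = sum +-0-commutativeMonoid

𝟙 : Bool → ℕ
𝟙 b = if b then 1 else 0

∑-lower-bound : ∀ {k} (f : Fin n → ℕ) → (∀ i → k ≤ f i) → n * k ≤ ∑ f
∑-lower-bound {zero}  f k≤f = z≤n
∑-lower-bound {suc n} f k≤f = +-mono-≤ (k≤f zero) (∑-lower-bound (f ∘ suc) (k≤f ∘ suc))

-- The tail already contributes at least `n * k`, so no more than `k` is left for the head;
-- cancelling the head gives the same situation for the tail.
∑-lower-bound-tight : ∀ {k} (f : Fin n → ℕ) → (∀ i → k ≤ f i) → ∑ f ≡ n * k → ∀ i → f i ≡ k
∑-lower-bound-tight {suc n} {k} f k≤f ∑≡ = λ where
    zero    → f₀≡k
    (suc i) → ∑-lower-bound-tight (f ∘ suc) (k≤f ∘ suc) ∑′≡ i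
  where
  f₀≡k : f zero ≡ k
  f₀≡k = ≤-antisym
    (+-cancelʳ-≤ (n * k) _ _
      (≤-trans (+-monoʳ-≤ (f zero) (∑-lower-bound (f ∘ suc) (k≤f ∘ suc))) (≤-reflexive ∑≡)))
    (k≤f zero)

  ∑′≡ : ∑ (f ∘ suc) ≡ n * k
  ∑′≡ = +-cancelˡ-≡ k _ _ (trans (cong (_+ ∑ (f ∘ suc)) (sym f₀≡k)) ∑≡)

module _ {A : Set} {P : Pred A 0ℓ} (P? : Decidable P) where

  length-filter-map-tabulate : ∀ {B : Set} (h : B → A) (g : Fin n → B) →
    length (filter P? (List.map h (List.tabulate g))) ≡ ∑ (λ j → 𝟙 (does (P? (h (g j)))))
  length-filter-map-tabulate {zero}  h g = refl
  length-filter-map-tabulate {suc n} h g with does (P? (h (g zero)))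
  ... | true  = cong suc (length-filter-map-tabulate h (g ∘ suc))
  ... | false = length-filter-map-tabulate h (g ∘ suc)

-- `allFin` is the tabulated identity; arbitrary `f` and `g` are allowed because the induction, row
-- by row, replaces `f` by `f ∘ suc`.
length-filter-cartesianProduct : ∀ {A B : Set} {P : Pred (A × B) 0ℓ} (P? : Decidable P)
  {m} (f : Fin m → A) (g : Fin n → B) →
  length (filter P? (cartesianProduct (List.tabulate f) (List.tabulate g))) ≡
  ∑ (λ i → ∑ (λ j → 𝟙 (does (P? (f i , g j)))))
length-filter-cartesianProduct P? {zero}  f g = refl
length-filter-cartesianProduct P? {suc m} f g = begin
  length (filter P? (row ++ rest))                  ≡⟨ cong length (filter-++ P? row rest) ⟩
  length (filter P? row ++ filter P? rest)          ≡⟨ length-++ (filter P? row) ⟩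
  length (filter P? row) + length (filter P? rest)
    ≡⟨ cong₂ _+_ (length-filter-map-tabulate P? (f zero ,_) g)
                 (length-filter-cartesianProduct P? (f ∘ suc) g) ⟩
  _ ∎
  where
  open ≡-Reasoning
  row  = List.map (f zero ,_) (List.tabulate g)
  rest = cartesianProduct (List.tabulate (f ∘ suc)) (List.tabulate g)

-- Subsets and their sizes.

module _ {P : Pred (Fin n) 0ℓ} (P? : Decidable P) where

  subset : Subset n
  subset = tabulate (does ∘ P?)

  ∈-subset⁺ : ∀ {x} → P x → x ∈ subset
  ∈-subset⁺ {x} px = lookup⇒[]= x _ (trans (lookup∘tabulate (does ∘ P?) x) (dec-true (P? x) px))

  ∈-subset⁻ : ∀ {x} → x ∈ subset → P x
  ∈-subset⁻ {x} x∈ with P? x | trans (sym (lookup∘tabulate (does ∘ P?) x)) ([]=⇒lookup x∈)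
  ... | yes px | _ = px
  ... | no _   | ()

∣tabulate∣ : (f : Fin n → Bool) → ∣ tabulate f ∣ ≡ ∑ (𝟙 ∘ f)
∣tabulate∣ {zero}  f = refl
∣tabulate∣ {suc n} f with f zero
... | true  = cong suc (∣tabulate∣ (f ∘ suc))
... | false = ∣tabulate∣ (f ∘ suc)

∣p∪q∣≤∣p∣+∣q∣ : (p q : Subset n) → ∣ p ∪ q ∣ ≤ ∣ p ∣ + ∣ q ∣
∣p∪q∣≤∣p∣+∣q∣ []            []            = z≤n
∣p∪q∣≤∣p∣+∣q∣ (outside ∷ p) (outside ∷ q) = ∣p∪q∣≤∣p∣+∣q∣ p q
∣p∪q∣≤∣p∣+∣q∣ (outside ∷ p) (inside ∷ q)  =
  ≤-trans (s≤s (∣p∪q∣≤∣p∣+∣q∣ p q)) (≤-reflexive (sym (+-suc ∣ p ∣ ∣ q ∣)))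
∣p∪q∣≤∣p∣+∣q∣ (inside ∷ p)  (outside ∷ q) = s≤s (∣p∪q∣≤∣p∣+∣q∣ p q)
∣p∪q∣≤∣p∣+∣q∣ (inside ∷ p)  (inside ∷ q)  =
  s≤s (≤-trans (∣p∪q∣≤∣p∣+∣q∣ p q) (+-monoʳ-≤ ∣ p ∣ (n≤1+n ∣ q ∣)))

∣p∪⁅x⁆∣≤1+∣p∣ : (p : Subset n) (x : Fin n) → ∣ p ∪ ⁅ x ⁆ ∣ ≤ suc ∣ p ∣
∣p∪⁅x⁆∣≤1+∣p∣ p x = begin
  ∣ p ∪ ⁅ x ⁆ ∣      ≤⟨ ∣p∪q∣≤∣p∣+∣q∣ p ⁅ x ⁆ ⟩
  ∣ p ∣ + ∣ ⁅ x ⁆ ∣  ≡⟨ cong (∣ p ∣ +_) (∣⁅x⁆∣≡1 x) ⟩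
  ∣ p ∣ + 1          ≡⟨ +-comm ∣ p ∣ 1 ⟩
  suc ∣ p ∣          ∎
  where open ≤-Reasoning

x∈p∪⁅x⁆ : (p : Subset n) (x : Fin n) → x ∈ p ∪ ⁅ x ⁆
x∈p∪⁅x⁆ p x = q⊆p∪q p ⁅ x ⁆ (x∈⁅x⁆ x)

p⊆q∧∣q∣≤∣p∣⇒q⊆p : {p q : Subset n} → p ⊆ q → ∣ q ∣ ≤ ∣ p ∣ → q ⊆ p
p⊆q∧∣q∣≤∣p∣⇒q⊆p {p = p} p⊆q ∣q∣≤∣p∣ {x} x∈q = decidable-stable (x ∈? p) λ x∉p →
  <-irrefl refl (≤-trans (p⊂q⇒∣p∣<∣q∣ (p⊆q , x , x∈q , x∉p)) ∣q∣≤∣p∣)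

extend-to-size : (p : Subset n) {k : ℕ} → ∣ p ∣ ≤ k → k ≤ n → ∃ λ q → p ⊆ q × ∣ q ∣ ≡ k
extend-to-size []            {zero} _ _ = [] , (λ ()) , refl
extend-to-size (inside ∷ p)  {suc k} (s≤s p≤k) (s≤s k≤n) =
  let q , p⊆q , ∣q∣≡k = extend-to-size p p≤k k≤n
  in inside ∷ q , in⊆in p⊆q , cong suc ∣q∣≡k
extend-to-size {suc n} (outside ∷ p) {k} p≤k k≤1+n with k ≤? n
... | yes k≤n =
  let q , p⊆q , ∣q∣≡k = extend-to-size p p≤k k≤n
  in outside ∷ q , out⊆ p⊆q , ∣q∣≡k
-- Here `k` must be `suc n`, so only the full set has the right size.
... | no  k≰n = ⊤ , ⊆⊤ , trans (∣⊤∣≡n (suc n)) (≤-antisym (≰⇒> k≰n) k≤1+n)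

-- Permutations moving a subset to an initial segment.

punchIn-< : (j : Fin (suc n)) (i : Fin n) → toℕ i < toℕ j ⇔ toℕ (punchIn j i) < toℕ j
punchIn-< zero    i       = mk⇔ (λ ()) (λ ())
punchIn-< (suc j) zero    = mk⇔ (λ _ → s≤s z≤n) (λ _ → s≤s z≤n)
punchIn-< (suc j) (suc i) = mk⇔ (s≤s ∘ to ∘ s≤s⁻¹) (s≤s ∘ from ∘ s≤s⁻¹)
  where open Equivalence (punchIn-< j i)

-- By induction: a first element inside `p` goes to the front, and one outside is inserted just
-- behind the images of the members of `p`.
ranking : (p : Subset n) → ∃ λ (π : Permutation′ n) → ∀ x → x ∈ p ⇔ toℕ (π ⟨$⟩ʳ x) < ∣ p ∣
ranking [] = id , λ ()
ranking (inside ∷ p) with ranking p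
... | π , rank = lift₀ π , λ where
  zero    → mk⇔ (λ _ → s≤s z≤n) (λ _ → here)
  (suc x) → mk⇔ (s≤s ∘ Equivalence.to (rank x) ∘ drop-there)
                (there ∘ Equivalence.from (rank x) ∘ s≤s⁻¹)
ranking {suc n} (outside ∷ p) with ranking p
... | π , rank = insert zero j π , λ where
    zero    → mk⇔ (λ ()) (λ j<∣p∣ → contradiction j<∣p∣ (<-irrefl j≡∣p∣))
    (suc x) → mk⇔ (to x ∘ drop-there) (there ∘ from x)
  where
  j : Fin (suc n)
  -- The value is `∣ p ∣`, the first position after the members, so the insertion shifts only
  -- nonmembers.
  j = fromℕ< (s≤s (∣p∣≤n p))

  j≡∣p∣ : toℕ j ≡ ∣ p ∣
  j≡∣p∣ = toℕ-fromℕ< (s≤s (∣p∣≤n p))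

  to : ∀ x → x ∈ p → toℕ (insert zero j π ⟨$⟩ʳ suc x) < ∣ p ∣
  to x x∈p rewrite insert-punchIn zero j π x =
    subst (toℕ (punchIn j (π ⟨$⟩ʳ x)) <_) j≡∣p∣ (Equivalence.to (punchIn-< j _)
      (subst (toℕ (π ⟨$⟩ʳ x) <_) (sym j≡∣p∣) (Equivalence.to (rank x) x∈p)))

  from : ∀ x → toℕ (insert zero j π ⟨$⟩ʳ suc x) < ∣ p ∣ → x ∈ p
  from x πx<∣p∣ rewrite insert-punchIn zero j π x =
    Equivalence.from (rank x) (subst (toℕ (π ⟨$⟩ʳ x) <_) j≡∣p∣ (Equivalence.from (punchIn-< j _)
      (subst (toℕ (punchIn j (π ⟨$⟩ʳ x)) <_) (sym j≡∣p∣) πx<∣p∣)))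

-- In-neighbourhoods and the edge count.

module _ (D : Digraph n) where
  open Digraph D

  N : Fin n → Subset n
  N v = subset (_⟶? v)

  ∈N⁺ : ∀ {x v} → x ⟶ v → x ∈ N v
  ∈N⁺ {v = v} = ∈-subset⁺ (_⟶? v)

  ∈N⁻ : ∀ {x v} → x ∈ N v → x ⟶ v
  ∈N⁻ {v = v} = ∈-subset⁻ (_⟶? v)

  -- The edge list counts by tails; exchanging the two sums counts by heads.
  handshake : ∣E∣ ≡ ∑ (λ v → ∣ N v ∣)
  handshake = begin
    ∣E∣                                          ≡⟨ length-filter-cartesianProduct (λ (x , y) → x ⟶? y) (λ x → x) (λ y → y) ⟩
    ∑ (λ x → ∑ (λ v → 𝟙 (does (x ⟶? v))))  ≡⟨ ∑-comm +-0-commutativeMonoid (λ x v → 𝟙 (does (x ⟶? v))) ⟩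
    ∑ (λ v → ∑ (λ x → 𝟙 (does (x ⟶? v))))  ≡⟨ sum-cong-≗ +-0-commutativeMonoid (λ v → ∣tabulate∣ (λ x → does (x ⟶? v))) ⟨
    ∑ (λ v → ∣ N v ∣)                            ∎
    where open ≡-Reasoning

-- Property S_k and the lower bound.

module _ {k : ℕ} (2≤k : 2 ≤ k) (D : Digraph n) (S : HasS k D) where
  open Digraph D
  open HasS S

  k≤n : k ≤ n
  k≤n = ≤-trans (n≤1+n k) order

  -- Property S_k speaks of sets of size exactly `k`; a smaller set is first enlarged.
  dominator : (p : Subset n) → ∣ p ∣ ≤ k → ∃ λ u → ∀ {v} → v ∈ p → u ⟶ v
  dominator p ∣p∣≤k =
    let q , p⊆q , ∣q∣≡k = extend-to-size p ∣p∣≤k k≤n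
        u , u⟶q         = dominated q ∣q∣≡k
    in u , u⟶q ∘ p⊆q

  dominator∪⁅_⁆ : ∀ {p} v → ∣ p ∣ < k → ∃ λ u → u ⟶ v × (∀ {x} → x ∈ p → u ⟶ x)
  dominator∪⁅_⁆ {p} v ∣p∣<k =
    let u , u⟶ = dominator (p ∪ ⁅ v ⁆) (≤-trans (∣p∪⁅x⁆∣≤1+∣p∣ p v) ∣p∣<k)
    in u , u⟶ (x∈p∪⁅x⁆ p v) , u⟶ ∘ p⊆p∪q ⁅ v ⁆

  dominator₂ : ∀ x y → ∃ λ u → u ⟶ x × u ⟶ y
  dominator₂ x y =
    let u , u⟶y , u⟶x = dominator∪⁅ y ⁆ (subst (_< k) (sym (∣⁅x⁆∣≡1 x)) 2≤k)
    in u , u⟶x (x∈⁅x⁆ x) , u⟶y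

  k≤indegree : ∀ v → k ≤ ∣ N D v ∣
  k≤indegree v = decidable-stable (k ≤? ∣ N D v ∣) λ k≰ →
    let u , u⟶v , u⟶N = dominator∪⁅ v ⁆ (≰⇒> k≰)
    in loopless u (u⟶N (∈N⁺ D u⟶v))

  n*k≤∣E∣ : n * k ≤ ∣E∣
  n*k≤∣E∣ = subst (n * k ≤_) (sym (handshake D)) (∑-lower-bound (λ v → ∣ N D v ∣) k≤indegree)

  -- The case of equality.

  module Extremal (∣E∣≡ : ∣E∣ ≡ n * k) where

    indegree≡k : ∀ v → ∣ N D v ∣ ≡ k
    indegree≡k = ∑-lower-bound-tight (λ v → ∣ N D v ∣) k≤indegree (trans (sym (handshake D)) ∣E∣≡)

    N-clique : ∀ {v x y} → x ⟶ v → y ⟶ v → x ≢ y → x ⟶ y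
    N-clique {v} {x} {y} x⟶v y⟶v x≢y
      with dominator∪⁅_⁆ {N D v - x} v
             (≤-trans (x∈p⇒∣p-x∣<∣p∣ (∈N⁺ D x⟶v)) (≤-reflexive (indegree≡k v)))
    ... | u , u⟶v , u⟶N-x with u ≟ x
    ...   | yes refl = u⟶N-x (x∈p∧x≢y⇒x∈p-y (∈N⁺ D y⟶v) (x≢y ∘ sym))
    -- A dominator other than `x` would itself lie in `N D v - x` and hence carry a loop.
    ...   | no  u≢x  = contradiction (u⟶N-x (x∈p∧x≢y⇒x∈p-y (∈N⁺ D u⟶v) u≢x)) (loopless u)

    module Clique {v₀ u₀ : Fin n} (u₀⟶ : ∀ {x} → x ⟶ v₀ → u₀ ⟶ x) where

      K : Subset n
      K = N D v₀ ∪ ⁅ u₀ ⁆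

      ∈K⁻ : ∀ {x} → x ∈ K → x ⟶ v₀ ⊎ x ≡ u₀
      ∈K⁻ x∈K with x∈p∪q⁻ (N D v₀) ⁅ u₀ ⁆ x∈K
      ... | inj₁ x∈N = inj₁ (∈N⁻ D x∈N)
      ... | inj₂ x∈u = inj₂ (x∈⁅y⁆⇒x≡y u₀ x∈u)

      u₀∈K : u₀ ∈ K
      u₀∈K = x∈p∪⁅x⁆ (N D v₀) u₀

      -- The vertex `u₀` is new: if it were in `N D v₀`, it would dominate itself.
      ∣K∣≡1+k : ∣ K ∣ ≡ suc k
      ∣K∣≡1+k = ≤-antisym
        (≤-trans (∣p∪⁅x⁆∣≤1+∣p∣ (N D v₀) u₀) (≤-reflexive (cong suc (indegree≡k v₀))))
        (subst (_< ∣ K ∣) (indegree≡k v₀) (p⊂q⇒∣p∣<∣q∣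
          (p⊆p∪q ⁅ u₀ ⁆ , u₀ , u₀∈K , λ u₀∈N → loopless u₀ (u₀⟶ (∈N⁻ D u₀∈N)))))

      -- Both x and u₀ are in-neighbours of any further in-neighbour z of v₀.
      ⟶u₀ : ∀ {x} → x ⟶ v₀ → x ⟶ u₀
      ⟶u₀ {x} x⟶v₀ with dominator₂ x v₀
      ... | z , z⟶x , z⟶v₀ = N-clique
        (N-clique x⟶v₀ z⟶v₀ λ { refl → loopless x z⟶x })
        (u₀⟶ z⟶v₀)
        λ { refl → loopless x (u₀⟶ x⟶v₀) }

      K-clique : ∀ {x y} → x ∈ K → y ∈ K → x ≢ y → x ⟶ y
      K-clique x∈K y∈K x≢y with ∈K⁻ x∈K | ∈K⁻ y∈K
      ... | inj₁ x⟶v₀ | inj₁ y⟶v₀ = N-clique x⟶v₀ y⟶v₀ x≢y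
      ... | inj₁ x⟶v₀ | inj₂ refl = ⟶u₀ x⟶v₀
      ... | inj₂ refl | inj₁ y⟶v₀ = u₀⟶ y⟶v₀
      ... | inj₂ refl | inj₂ refl = contradiction refl x≢y

      -- The other `k` members of the clique `K` are in-neighbours of `x`, which has in-degree `k`;
      -- so there is no room for an in-neighbour outside `K`.
      K-closed : ∀ {x y} → x ∈ K → y ⟶ x → y ∈ K
      K-closed {x} x∈K y⟶x = p⊆q∧∣q∣≤∣p∣⇒q⊆p K⊆N∪x ∣N∪x∣≤∣K∣ (p⊆p∪q ⁅ x ⁆ (∈N⁺ D y⟶x))
        where
        K⊆N∪x : K ⊆ N D x ∪ ⁅ x ⁆
        K⊆N∪x {z} z∈K with z ≟ x
        ... | yes refl = x∈p∪⁅x⁆ (N D x) x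
        ... | no  z≢x  = p⊆p∪q ⁅ x ⁆ (∈N⁺ D (K-clique z∈K x∈K z≢x))

        ∣N∪x∣≤∣K∣ : ∣ N D x ∪ ⁅ x ⁆ ∣ ≤ ∣ K ∣
        ∣N∪x∣≤∣K∣ = ≤-trans (∣p∪⁅x⁆∣≤1+∣p∣ (N D x) x)
          (≤-reflexive (trans (cong suc (indegree≡k x)) (sym ∣K∣≡1+k)))

      tail∈K : ∀ {y w} → y ⟶ w → y ∈ K
      -- The member of `K` paired with `w` is `u₀`; the common dominator `z` is in `K` by closure,
      -- and so is every in-neighbour of `z`.
      tail∈K {y} {w} y⟶w with dominator₂ u₀ w
      ... | z , z⟶u₀ , z⟶w with y ≟ z
      ...   | yes refl = K-closed u₀∈K z⟶u₀
      ...   | no  y≢z  = K-closed (K-closed u₀∈K z⟶u₀) (N-clique y⟶w z⟶w y≢z)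

      -- Relabelling to a member of the extremal family.

      π : Permutation′ n
      π = proj₁ (ranking K)

      π⁻¹ : Fin n → Fin n
      π⁻¹ = π ⟨$⟩ˡ_

      Core⇔∈K : ∀ x → Core k (π ⟨$⟩ʳ x) ⇔ x ∈ K
      Core⇔∈K x = mk⇔ (from ∘ subst (toℕ (π ⟨$⟩ʳ x) <_) (sym ∣K∣≡1+k))
                      (subst (toℕ (π ⟨$⟩ʳ x) <_) ∣K∣≡1+k ∘ to)
        where open Equivalence (proj₂ (ranking K) x)

      core⇒∈K : ∀ {x} → Core k x → π⁻¹ x ∈ K
      core⇒∈K {x} c = Equivalence.to (Core⇔∈K (π⁻¹ x)) (subst (Core k) (sym (inverseʳ π)) c)

      ∈K⇒core : ∀ {x} → π⁻¹ x ∈ K → Core k x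
      ∈K⇒core {x} x∈K = subst (Core k) (inverseʳ π) (Equivalence.from (Core⇔∈K (π⁻¹ x)) x∈K)

      -- This is `D` transported along `π`, which places `K` on the first `k + 1` vertices.
      A : Digraph n
      A = record
        { _⟶_      = λ x y → π⁻¹ x ⟶ π⁻¹ y
        ; _⟶?_     = λ x y → π⁻¹ x ⟶? π⁻¹ y
        ; loopless = λ x → loopless (π⁻¹ x)
        }

      -- Relabelling only permutes the summands of an in-degree of `D`.
      A-indegree : ∀ y → ∣ N A y ∣ ≡ k
      A-indegree y = begin
        ∣ N A y ∣                                  ≡⟨ ∣tabulate∣ (λ x → does (π⁻¹ x ⟶? π⁻¹ y)) ⟩
        ∑ (λ x → 𝟙 (does (π⁻¹ x ⟶? π⁻¹ y)))  ≡⟨ sum-permute +-0-commutativeMonoid (λ x → 𝟙 (does (x ⟶? π⁻¹ y))) (flip π) ⟨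
        ∑ (λ x → 𝟙 (does (x ⟶? π⁻¹ y)))      ≡⟨ ∣tabulate∣ (λ x → does (x ⟶? π⁻¹ y)) ⟨
        ∣ N D (π⁻¹ y) ∣                            ≡⟨ indegree≡k (π⁻¹ y) ⟩
        k                                          ∎
        where open ≡-Reasoning

      A∈𝒜 : 𝒜 n k A
      A∈𝒜 = record
        { order       = order
        -- Every in-neighbourhood of `A` has size `k` and, by `tail∈K`, lies in the core.
        ; choice      = N A
        ; choice-core = λ i _ x∈N → ∈K⇒core (tail∈K (∈N⁻ A {v = i} x∈N))
        ; choice-size = λ i _ → A-indegree i
        ; edge⇔       = λ x y → mk⇔ (edge⇒ x y) (edge⇐ x y)
        }
        where
        edge⇒ : ∀ x y → π⁻¹ x ⟶ π⁻¹ y → (Core k x × Core k y × x ≢ y) ⊎ (¬ Core k y × x ∈ N A y)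
        edge⇒ x y x⟶y with toℕ y <? suc k
        ... | yes c = inj₁ (∈K⇒core (tail∈K x⟶y) , c , λ { refl → loopless _ x⟶y })
        ... | no ¬c = inj₂ (¬c , ∈N⁺ A {v = y} x⟶y)

        edge⇐ : ∀ x y → (Core k x × Core k y × x ≢ y) ⊎ (¬ Core k y × x ∈ N A y) → π⁻¹ x ⟶ π⁻¹ y
        edge⇐ x y (inj₁ (cx , cy , x≢y)) = K-clique (core⇒∈K cx) (core⇒∈K cy) λ eq →
          x≢y (trans (sym (inverseʳ π)) (trans (cong (π ⟨$⟩ʳ_) eq) (inverseʳ π)))
        edge⇐ x y (inj₂ (_ , x∈N)) = ∈N⁻ A {v = y} x∈N

      D≅A : D ≅ A
      D≅A = π , λ x y → mk⇔
        (subst₂ _⟶_ (sym (inverseˡ π)) (sym (inverseˡ π)))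
        (subst₂ _⟶_ (inverseˡ π) (inverseˡ π))

lemma6 : ∀ (k n : ℕ) → 2 ≤ k → (D : Digraph n) → HasS k D →
    (k * n ≤ Digraph.∣E∣ D) ×
    (Digraph.∣E∣ D ≡ k * n → ∃ λ (A : Digraph n) → 𝒜 n k A × D ≅ A)
lemma6 k n 2≤k D S rewrite *-comm k n = n*k≤∣E∣ 2≤k D S , λ ∣E∣≡ →
  let open Extremal 2≤k D S ∣E∣≡
      -- Any vertex would serve; the first one exists because the order is at least `k + 1`.
      v₀       = fromℕ< (≤-trans (s≤s z≤n) (HasS.order S))
      _ , u₀⟶N = dominator 2≤k D S (N D v₀) (≤-reflexive (indegree≡k v₀))
      open Clique {v₀} (u₀⟶N ∘ ∈N⁺ D)
  in A , A∈𝒜 , D≅A
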